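{- Let $m,t,n,\lambda$ be positive integers with $m-1>t>0$. Suppose there exists a $(t+1)$-color connected colored edge graph $G(V,E,C,f)$ with $|V|=n$, $|E|=\lambda$ and $|C|=m$. Then $2\lambda\ge (t+1)n$, and the following conditions hold: \begin{itemize} \item if $n=(m-t)k$ for some integer $k>0$, then $\lambda\ge mk-1$; \item if $n=(m-t)k+1$ for some integer $k>0$, then $\lambda\ge mk$; \item for every integer $j$ with $2\le j\le m-t-1$: if $n=(m-t)k+j$ for some integer $k>0$, then $\lambda\ge mk+t+j-1$. \end{itemize}
   Context: All graphs are finite, undirected and simple (no loops, no multiple edges). A colored edge graph is a tuple $G(V,E,C,f)$ where $(V,E)$ is a graph with node set $V$ and edge set $E$, $C$ is a finite set of colors, and $f:E\to C$ is a surjective map. For an integer $t\ge 1$, two distinct nodes $A,B\in V$ are $(t+1)$-color connected if for every color set $C_t\subseteq C$ with $|C_t|=t$ there is a path from $A$ to $B$ in $G$ none of whose edges has a color in $C_t$. The colored edge graph $G$ is $(t+1)$-color connected if every two distinct nodes of $G$ are $(t+1)$-color connected. -}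

module Defs where

open import Data.Nat using (ℕ)
open import Data.Fin using (Fin)
open import Data.Fin.Subset using (Subset; ⁅_⁆; _∪_; _∉_; ∣_∣)
open import Data.List using (List; []; _∷_)
open import Data.List.Relation.Unary.All using (All)
open import Data.List.Relation.Unary.Unique.Propositional using (Unique)
open import Data.Product using (Σ-syntax; _×_)
open import Function.Definitions using (Injective; Surjective)
open import Relation.Binary.PropositionalEquality using (_≡_; _≢_)

-- The finite sets V, E and C are represented by their canonical
-- enumerations.  An edge is a two-element subset of V, which excludes loops
-- and directions; injectivity of `ends` excludes multiple edges.
record ColoredEdgeGraph : Set where
  field
    ∣V∣ ∣E∣ ∣C∣      : ℕ
    ends             : Fin ∣E∣ → Subset ∣V∣
    ends-size        : ∀ e → ∣ ends e ∣ ≡ 2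
    ends-injective   : Injective _≡_ _≡_ ends
    color            : Fin ∣E∣ → Fin ∣C∣
    color-surjective : Surjective _≡_ _≡_ color

  V E : Set
  V = Fin ∣V∣
  E = Fin ∣E∣

module _ (G : ColoredEdgeGraph) where
  open ColoredEdgeGraph G

  data Walk : V → V → Set where
    stop : ∀ {A} → Walk A A
    step : ∀ {A B D} (e : E) → ends e ≡ ⁅ A ⁆ ∪ ⁅ B ⁆ → Walk B D → Walk A D

  walkNodes : ∀ {A B} → Walk A B → List V
  walkNodes {A} stop         = A ∷ []
  walkNodes {A} (step _ _ w) = A ∷ walkNodes w

  walkEdges : ∀ {A B} → Walk A B → List E
  walkEdges stop         = []
  walkEdges (step e _ w) = e ∷ walkEdges w

  IsPath : ∀ {A B} → Walk A B → Set
  IsPath w = Unique (walkNodes w)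

  Avoids : ∀ {A B} → Subset ∣C∣ → Walk A B → Set
  Avoids S w = All (λ e → color e ∉ S) (walkEdges w)

  -- The index is t, the number of removed colors, and not t + 1.
  [_+1]-ColorConnectedNodes : ℕ → V → V → Set
  [_+1]-ColorConnectedNodes t A B =
    ∀ (S : Subset ∣C∣) → ∣ S ∣ ≡ t → Σ[ w ∈ Walk A B ] (IsPath w × Avoids S w)

[_+1]-ColorConnected : ℕ → ColoredEdgeGraph → Set
[ t +1]-ColorConnected G =
  ∀ (A B : ColoredEdgeGraph.V G) → A ≢ B → [_+1]-ColorConnectedNodes G t A B

{-# OPTIONS --safe #-}
-- Fix a threshold p with (m − t) p < n − 1 and choose a set S of t colors such
-- that either every color in S is used more than p times, or every color outside
-- S is used at most p times.  The edges with colors outside S connect the graph,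
-- so there are at least n − 1 > (m − t) p of them; this excludes the second
-- alternative, and the first gives λ ≥ t (p + 1) + (n − 1).  The three bounds
-- are the cases p = k − 1, p = k − 1 and p = k.  The degree bound holds because
-- a node whose edges have at most t colors is isolated by removing them.
module Submission where

open import Data.Bool using (not)
open import Data.Nat using (ℕ; zero; suc; _+_; _*_; _∸_; _≤_; _<_; _≥_; _>_; z≤n; s≤s; _≤?_)
open import Data.Nat.Properties
open import Data.Fin using (Fin; zero; suc)
open import Data.Fin.Subset
  using (Subset; Side; inside; outside; ⁅_⁆; ⊥; ⊤; ∁; _∪_; _∈_; _∉_; _⊆_; ∣_∣)
open import Data.Fin.Subset.Properties
open import Data.List.Relation.Unary.All using ([]; _∷_)
open import Data.Product using (Σ-syntax; ∃-syntax; _×_; _,_)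
open import Data.Nat.Solver using (module +-*-Solver)
open import Data.Sum using (_⊎_; inj₁; inj₂; [_,_]′)
open import Data.Vec using ([]; _∷_; here; there; lookup; tabulate)
open import Data.Vec.Properties
  using ([]=⇒lookup; lookup⇒[]=; lookup∘tabulate; tabulate-cong; tabulate-∘; lookup-map)
open import Function using (_∘_)
open import Relation.Binary.PropositionalEquality
open import Relation.Nullary using (¬_; Dec; yes; no; contradiction)
open import Algebra.Properties.Semiring.Sum +-*-semiring
  using (sum; ∑-comm; sum-cong-≗; *-distribˡ-sum; *-distribʳ-sum)
open import Defs
open ColoredEdgeGraph using (∣V∣; ∣E∣; ∣C∣)

private variable
  a b n t : ℕ

-- Finite subsets: indicator sums, unions, images, choice of a subset of given size.

𝟙 : Side → ℕ
𝟙 inside  = 1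
𝟙 outside = 0

∣p∣≡sum : (p : Subset n) → ∣ p ∣ ≡ sum (λ i → 𝟙 (lookup p i))
∣p∣≡sum []            = refl
∣p∣≡sum (inside  ∷ p) = cong suc (∣p∣≡sum p)
∣p∣≡sum (outside ∷ p) = ∣p∣≡sum p

∣tabulate∣ : (f : Fin n → Side) → ∣ tabulate f ∣ ≡ sum (𝟙 ∘ f)
∣tabulate∣ f = trans (∣p∣≡sum (tabulate f)) (sum-cong-≗ (cong 𝟙 ∘ lookup∘tabulate f))

∈-tabulate⁺ : (f : Fin n → Side) {i : Fin n} → f i ≡ inside → i ∈ tabulate f
∈-tabulate⁺ f {i} eq = lookup⇒[]= i _ (trans (lookup∘tabulate f i) eq)

∣p∪q∣≤∣p∣+∣q∣ : (p q : Subset n) → ∣ p ∪ q ∣ ≤ ∣ p ∣ + ∣ q ∣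
∣p∪q∣≤∣p∣+∣q∣ []            []            = z≤n
∣p∪q∣≤∣p∣+∣q∣ (inside  ∷ p) (inside  ∷ q) =
  s≤s (≤-trans (∣p∪q∣≤∣p∣+∣q∣ p q) (+-monoʳ-≤ ∣ p ∣ (n≤1+n _)))
∣p∪q∣≤∣p∣+∣q∣ (inside  ∷ p) (outside ∷ q) = s≤s (∣p∪q∣≤∣p∣+∣q∣ p q)
∣p∪q∣≤∣p∣+∣q∣ (outside ∷ p) (inside  ∷ q) =
  ≤-trans (s≤s (∣p∪q∣≤∣p∣+∣q∣ p q)) (≤-reflexive (sym (+-suc ∣ p ∣ ∣ q ∣)))
∣p∪q∣≤∣p∣+∣q∣ (outside ∷ p) (outside ∷ q) = ∣p∪q∣≤∣p∣+∣q∣ p q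

∣⁅x⁆∪p∣≤1+∣p∣ : (x : Fin n) (p : Subset n) → ∣ ⁅ x ⁆ ∪ p ∣ ≤ suc ∣ p ∣
∣⁅x⁆∪p∣≤1+∣p∣ x p =
  subst (λ c → ∣ ⁅ x ⁆ ∪ p ∣ ≤ c + ∣ p ∣) (∣⁅x⁆∣≡1 x) (∣p∪q∣≤∣p∣+∣q∣ ⁅ x ⁆ p)

x∉p⇒∣p∣<∣⁅x⁆∪p∣ : {x : Fin n} {p : Subset n} → x ∉ p → ∣ p ∣ < ∣ ⁅ x ⁆ ∪ p ∣
x∉p⇒∣p∣<∣⁅x⁆∪p∣ {x = x} {p} x∉p =
  p⊂q⇒∣p∣<∣q∣ (q⊆p∪q ⁅ x ⁆ p , x , p⊆p∪q p (x∈⁅x⁆ x) , x∉p)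

∣p∣<n⇒∃∉ : (p : Subset n) → ∣ p ∣ < n → ∃[ x ] x ∉ p
∣p∣<n⇒∃∉ (outside ∷ p) _         = zero , λ ()
∣p∣<n⇒∃∉ (inside  ∷ p) (s≤s lt) with x , x∉p ← ∣p∣<n⇒∃∉ p lt =
  suc x , λ { (there x∈p) → x∉p x∈p }

image : (Fin a → Fin b) → Subset a → Subset b
image f []            = ⊥
image f (inside  ∷ p) = ⁅ f zero ⁆ ∪ image (f ∘ suc) p
image f (outside ∷ p) = image (f ∘ suc) p

∣image∣≤∣p∣ : (f : Fin a → Fin b) (p : Subset a) → ∣ image f p ∣ ≤ ∣ p ∣
∣image∣≤∣p∣ {b = b} f []  = ≤-reflexive (∣⊥∣≡0 b)
∣image∣≤∣p∣ f (inside  ∷ p) =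
  ≤-trans (∣⁅x⁆∪p∣≤1+∣p∣ (f zero) _) (s≤s (∣image∣≤∣p∣ (f ∘ suc) p))
∣image∣≤∣p∣ f (outside ∷ p) = ∣image∣≤∣p∣ (f ∘ suc) p

∈-image⁺ : (f : Fin a → Fin b) {p : Subset a} {x : Fin a} → x ∈ p → f x ∈ image f p
∈-image⁺ f here = p⊆p∪q _ (x∈⁅x⁆ (f zero))
∈-image⁺ f {inside  ∷ p} (there x∈p) = q⊆p∪q ⁅ f zero ⁆ _ (∈-image⁺ (f ∘ suc) x∈p)
∈-image⁺ f {outside ∷ p} (there x∈p) = ∈-image⁺ (f ∘ suc) x∈p

-- If at least `t` indices satisfy `P`, then `S` can be chosen among them; otherwise `S` can be
-- chosen to contain them all. The recursion is greedy: an index satisfying `P` is taken while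
-- places remain, and one failing `P` is skipped unless too few indices would be left.
subsetInsideOrOutside : {P : Fin n → Set} → (∀ i → Dec (P i)) → t ≤ n →
  Σ[ S ∈ Subset n ] (∣ S ∣ ≡ t × ((∀ i → i ∈ S → P i) ⊎ (∀ i → i ∉ S → ¬ P i)))
subsetInsideOrOutside {n = n} {t = zero} P? _ =
  ⊥ , ∣⊥∣≡0 n , inj₁ λ i i∈⊥ → contradiction i∈⊥ ∉⊥
subsetInsideOrOutside {n = suc n} {t = suc t} P? (s≤s t≤n) with P? zero
... | yes P0 with subsetInsideOrOutside (P? ∘ suc) t≤n
...   | S , ∣S∣≡t , inj₁ S⊆P = inside ∷ S , cong suc ∣S∣≡t ,
          inj₁ λ { zero _ → P0 ; (suc i) (there i∈S) → S⊆P i i∈S }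
...   | S , ∣S∣≡t , inj₂ P⊆S = inside ∷ S , cong suc ∣S∣≡t ,
          inj₂ λ { zero 0∉S → contradiction here 0∉S ; (suc i) i∉S → P⊆S i (i∉S ∘ there) }
subsetInsideOrOutside {n = suc n} {t = suc t} P? (s≤s t≤n) | no ¬P0 with suc t ≤? n
-- Here `t` equals `n`, so all indices are taken and nothing lies outside `S`.
... | no 1+t≰n = ⊤ , trans (∣⊤∣≡n (suc n)) (cong suc (≤-antisym (≮⇒≥ 1+t≰n) t≤n)) ,
      inj₂ λ i i∉⊤ → contradiction ∈⊤ i∉⊤
... | yes 1+t≤n with subsetInsideOrOutside (P? ∘ suc) 1+t≤n
...   | S , ∣S∣≡t , inj₁ S⊆P = outside ∷ S , ∣S∣≡t ,
          inj₁ λ { (suc i) (there i∈S) → S⊆P i i∈S }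
...   | S , ∣S∣≡t , inj₂ P⊆S = outside ∷ S , ∣S∣≡t ,
          inj₂ λ { zero _ → ¬P0 ; (suc i) i∉S → P⊆S i (i∉S ∘ there) }

-- Finite sums and double counting.

sum-mono-≤ : {f g : Fin n → ℕ} → (∀ i → f i ≤ g i) → sum f ≤ sum g
sum-mono-≤ {zero}  f≤g = z≤n
sum-mono-≤ {suc n} f≤g = +-mono-≤ (f≤g zero) (sum-mono-≤ (f≤g ∘ suc))

sum-const : ∀ n c → sum {n} (λ _ → c) ≡ n * c
sum-const zero    c = refl
sum-const (suc n) c = cong (c +_) (sum-const n c)

-- The indicator of a singleton is a Kronecker delta, so only the summand at `x` survives.
sum-*-𝟙⁅x⁆ : (g : Fin n → ℕ) (x : Fin n) → sum (λ i → g i * 𝟙 (lookup ⁅ x ⁆ i)) ≡ g x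
sum-*-𝟙⁅x⁆ {suc n} g zero = begin
  g zero * 1 + sum (λ i → g (suc i) * 𝟙 (lookup (⊥ {n}) i))
    ≡⟨ cong₂ _+_ (*-identityʳ (g zero)) (trans (sum-cong-≗ off) (sum-const n 0)) ⟩
  g zero + n * 0
    ≡⟨ cong (g zero +_) (*-zeroʳ n) ⟩
  g zero + 0
    ≡⟨ +-identityʳ (g zero) ⟩
  g zero ∎
  where
  open ≡-Reasoning
  lookup-⊥ : ∀ {n} (i : Fin n) → lookup (⊥ {n}) i ≡ outside
  lookup-⊥ zero    = refl
  lookup-⊥ (suc i) = lookup-⊥ i
  off : ∀ i → g (suc i) * 𝟙 (lookup (⊥ {n}) i) ≡ 0
  off i = trans (cong (λ s → g (suc i) * 𝟙 s) (lookup-⊥ i)) (*-zeroʳ (g (suc i)))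
sum-*-𝟙⁅x⁆ g (suc x) = cong₂ _+_ (*-zeroʳ (g zero)) (sum-*-𝟙⁅x⁆ (g ∘ suc) x)

-- A family of subsets is read as a 0-1 incidence matrix. Transposing gives the star of a node from
-- `ends` and the fibres of a map from its singleton values.
transpose : (Fin a → Subset b) → Fin b → Subset a
transpose F j = tabulate (λ i → lookup (F i) j)

∈-transpose⁺ : (F : Fin a → Subset b) {i : Fin a} {j : Fin b} → j ∈ F i → i ∈ transpose F j
∈-transpose⁺ F j∈Fi = ∈-tabulate⁺ _ ([]=⇒lookup j∈Fi)

-- Both sides count the pairs `(i , j)` with `j ∈ F i`, by rows and by columns.
double-counting : (F : Fin a → Subset b) →
  sum (λ i → ∣ F i ∣) ≡ sum (λ j → ∣ transpose F j ∣)
double-counting F = begin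
  sum (λ i → ∣ F i ∣)                      ≡⟨ sum-cong-≗ (λ i → ∣p∣≡sum (F i)) ⟩
  sum (λ i → sum λ j → 𝟙 (lookup (F i) j)) ≡⟨ ∑-comm (λ i j → 𝟙 (lookup (F i) j)) ⟩
  sum (λ j → sum λ i → 𝟙 (lookup (F i) j)) ≡⟨ sum-cong-≗ (λ j → ∣tabulate∣ (λ i → lookup (F i) j)) ⟨
  sum (λ j → ∣ transpose F j ∣)            ∎
  where open ≡-Reasoning

-- Preimages and fibres of a map between finite sets.

module _ (f : Fin a → Fin b) where

  preimage : Subset b → Subset a
  preimage S = tabulate (lookup S ∘ f)

  fibre : Fin b → Subset a
  fibre = transpose (⁅_⁆ ∘ f)

  ∈-preimage⁺ : {S : Subset b} {x : Fin a} → f x ∈ S → x ∈ preimage S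
  ∈-preimage⁺ fx∈S = ∈-tabulate⁺ _ ([]=⇒lookup fx∈S)

  preimage-∁ : (S : Subset b) → preimage (∁ S) ≡ ∁ (preimage S)
  preimage-∁ S = trans (tabulate-cong (λ x → lookup-map (f x) not S)) (tabulate-∘ not _)

  ∣preimage∣+∣preimage-∁∣ : (S : Subset b) → ∣ preimage S ∣ + ∣ preimage (∁ S) ∣ ≡ a
  ∣preimage∣+∣preimage-∁∣ S = begin
    ∣ preimage S ∣ + ∣ preimage (∁ S) ∣ ≡⟨ cong (λ p → ∣ preimage S ∣ + ∣ p ∣) (preimage-∁ S) ⟩
    ∣ preimage S ∣ + ∣ ∁ (preimage S) ∣ ≡⟨ cong (∣ preimage S ∣ +_) (∣∁p∣≡n∸∣p∣ (preimage S)) ⟩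
    ∣ preimage S ∣ + (a ∸ ∣ preimage S ∣) ≡⟨ m+[n∸m]≡n (∣p∣≤n (preimage S)) ⟩
    a ∎
    where open ≡-Reasoning

  -- Expanding the indicator of `f x ∈ S` as a sum over all `i`, by the Kronecker delta, allows the
  -- sums over `x` and `i` to be exchanged; the inner sum is then the size of a fibre.
  ∣preimage∣≡sum-fibres : (S : Subset b) →
    ∣ preimage S ∣ ≡ sum (λ i → 𝟙 (lookup S i) * ∣ fibre i ∣)
  ∣preimage∣≡sum-fibres S = begin
    ∣ preimage S ∣
      ≡⟨ ∣tabulate∣ (lookup S ∘ f) ⟩
    sum (λ x → 𝟙 (lookup S (f x)))
      ≡⟨ sum-cong-≗ (λ x → sum-*-𝟙⁅x⁆ (λ i → 𝟙 (lookup S i)) (f x)) ⟨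
    sum (λ x → sum λ i → 𝟙 (lookup S i) * 𝟙 (lookup ⁅ f x ⁆ i))
      ≡⟨ ∑-comm (λ x i → 𝟙 (lookup S i) * 𝟙 (lookup ⁅ f x ⁆ i)) ⟩
    sum (λ i → sum λ x → 𝟙 (lookup S i) * 𝟙 (lookup ⁅ f x ⁆ i))
      ≡⟨ sum-cong-≗ (λ i → *-distribˡ-sum (𝟙 (lookup S i)) (λ x → 𝟙 (lookup ⁅ f x ⁆ i))) ⟨
    sum (λ i → 𝟙 (lookup S i) * sum λ x → 𝟙 (lookup ⁅ f x ⁆ i))
      ≡⟨ sum-cong-≗ (λ i → cong (𝟙 (lookup S i) *_) (∣tabulate∣ (λ x → lookup ⁅ f x ⁆ i))) ⟨
    sum (λ i → 𝟙 (lookup S i) * ∣ fibre i ∣) ∎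
    where open ≡-Reasoning

  private
    ∣S∣*q≡sum : (S : Subset b) (q : ℕ) → ∣ S ∣ * q ≡ sum (λ i → 𝟙 (lookup S i) * q)
    ∣S∣*q≡sum S q = trans (cong (_* q) (∣p∣≡sum S)) (*-distribʳ-sum q (λ i → 𝟙 (lookup S i)))

    weighted : (S : Subset b) {g h : Fin b → ℕ} → (∀ i → i ∈ S → g i ≤ h i) →
      ∀ i → 𝟙 (lookup S i) * g i ≤ 𝟙 (lookup S i) * h i
    weighted S g≤h i with lookup S i in eq
    ... | inside  = *-monoʳ-≤ 1 (g≤h i (lookup⇒[]= i S eq))
    ... | outside = z≤n

  ∣preimage∣-lower : (S : Subset b) (q : ℕ) → (∀ i → i ∈ S → q ≤ ∣ fibre i ∣) →
    ∣ S ∣ * q ≤ ∣ preimage S ∣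
  ∣preimage∣-lower S q q≤ = begin
    ∣ S ∣ * q                                ≡⟨ ∣S∣*q≡sum S q ⟩
    sum (λ i → 𝟙 (lookup S i) * q)           ≤⟨ sum-mono-≤ (weighted S q≤) ⟩
    sum (λ i → 𝟙 (lookup S i) * ∣ fibre i ∣) ≡⟨ ∣preimage∣≡sum-fibres S ⟨
    ∣ preimage S ∣                           ∎
    where open ≤-Reasoning

  ∣preimage∣-upper : (S : Subset b) (q : ℕ) → (∀ i → i ∈ S → ∣ fibre i ∣ ≤ q) →
    ∣ preimage S ∣ ≤ ∣ S ∣ * q
  ∣preimage∣-upper S q ≤q = begin
    ∣ preimage S ∣                           ≡⟨ ∣preimage∣≡sum-fibres S ⟩
    sum (λ i → 𝟙 (lookup S i) * ∣ fibre i ∣) ≤⟨ sum-mono-≤ (weighted S ≤q) ⟩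
    sum (λ i → 𝟙 (lookup S i) * q)           ≡⟨ ∣S∣*q≡sum S q ⟨
    ∣ S ∣ * q                                ∎
    where open ≤-Reasoning

-- Edges on walks and the degree bound.

∃≢ : 2 ≤ n → (x : Fin n) → ∃[ y ] x ≢ y
∃≢ (s≤s (s≤s _)) zero    = suc zero , λ ()
∃≢ (s≤s (s≤s _)) (suc x) = zero , λ ()

module _ (G : ColoredEdgeGraph) where
  open ColoredEdgeGraph G hiding (∣V∣; ∣E∣; ∣C∣)

  star : V → Subset (∣E∣ G)
  star = transpose ends

  -- The edge found is that of the first step leaving `W`. It is what extends a tree with node set
  -- `W`.
  exitEdge : ∀ {S A B} (W : Subset (∣V∣ G)) (w : Walk G A B) → Avoids G S w → A ∈ W → B ∉ W →
    ∃[ e ] ∃[ X ] ∃[ Y ] (ends e ≡ ⁅ X ⁆ ∪ ⁅ Y ⁆ × color e ∉ S × X ∈ W × Y ∉ W)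
  exitEdge W stop [] A∈W A∉W = contradiction A∈W A∉W
  exitEdge W (step {A} {B} e eq w) (e∉S ∷ av) A∈W D∉W with B ∈? W
  ... | yes B∈W = exitEdge W w av B∈W D∉W
  ... | no  B∉W = e , A , B , eq , e∉S , A∈W , B∉W

  startEdge : ∀ {S A B} → A ≢ B → (w : Walk G A B) → Avoids G S w → ∃[ e ] (A ∈ ends e × color e ∉ S)
  startEdge A≢B stop             _         = contradiction refl A≢B
  startEdge A≢B (step {A} e eq _) (e∉S ∷ _) =
    e , subst (A ∈_) (sym eq) (p⊆p∪q _ (x∈⁅x⁆ A)) , e∉S

  module _ {t : ℕ} (conn : [ t +1]-ColorConnected G) (t≤∣C∣ : t ≤ ∣C∣ G) where

    -- The set `S` is comparable with the set of colors at `A`. A walk from `A` avoiding `S` begins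
    -- with an edge at `A` whose color is not in `S`, so `S` is a proper subset of these colors, and
    -- there are no more of them than edges at `A`.
    t<∣star∣ : 2 ≤ ∣V∣ G → (A : V) → t < ∣ star A ∣
    t<∣star∣ 2≤∣V∣ A
      with B , A≢B ← ∃≢ 2≤∣V∣ A
      with S , ∣S∣≡t , choice ← subsetInsideOrOutside (λ c → c ∈? image color (star A)) t≤∣C∣
      with w , _ , av ← conn A B A≢B S ∣S∣≡t
      with e , A∈e , ce∉S ← startEdge A≢B w av
      with ce∈ ← ∈-image⁺ color (∈-transpose⁺ ends A∈e)
      with choice
    ... | inj₁ S⊆ = subst (_< ∣ star A ∣) ∣S∣≡t
          (<-≤-trans (p⊂q⇒∣p∣<∣q∣ ((λ {c} → S⊆ c) , color e , ce∈ , ce∉S))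
            (∣image∣≤∣p∣ color (star A)))
    ... | inj₂ ∉S⇒∉ = contradiction ce∈ (∉S⇒∉ _ ce∉S)

    -- The handshake lemma: the degrees sum to twice the number of edges, and each degree is at
    -- least `suc t`.
    [t+1]*∣V∣≤2*∣E∣ : 2 ≤ ∣V∣ G → (t + 1) * ∣V∣ G ≤ 2 * ∣E∣ G
    [t+1]*∣V∣≤2*∣E∣ 2≤∣V∣ = begin
      (t + 1) * ∣V∣ G          ≡⟨ *-comm (t + 1) (∣V∣ G) ⟩
      ∣V∣ G * (t + 1)          ≡⟨ cong (∣V∣ G *_) (+-comm t 1) ⟩
      ∣V∣ G * suc t            ≡⟨ sum-const (∣V∣ G) (suc t) ⟨
      sum {∣V∣ G} (λ _ → suc t) ≤⟨ sum-mono-≤ (t<∣star∣ 2≤∣V∣) ⟩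
      sum (λ A → ∣ star A ∣)   ≡⟨ double-counting ends ⟨
      sum (λ e → ∣ ends e ∣)   ≡⟨ sum-cong-≗ ends-size ⟩
      sum {∣E∣ G} (λ _ → 2)    ≡⟨ sum-const (∣E∣ G) 2 ⟩
      ∣E∣ G * 2                ≡⟨ *-comm (∣E∣ G) 2 ⟩
      2 * ∣E∣ G                ∎
      where open ≤-Reasoning

    -- Spanning trees in the colors outside `S`.

    module _ (S : Subset (∣C∣ G)) (∣S∣≡t : ∣ S ∣ ≡ t) where

      -- `W` and `F` are the nodes and edges of a tree after `k` extensions. Keeping `root` in `W`
      -- gives the next walk its start; keeping the ends of `F` inside `W` makes each added edge
      -- new.
      growTree : (root : V) (k : ℕ) → k < ∣V∣ G →
        Σ[ W ∈ Subset (∣V∣ G) ] Σ[ F ∈ Subset (∣E∣ G) ]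
          (root ∈ W × ∣ W ∣ ≡ suc k × k ≤ ∣ F ∣
           × F ⊆ preimage color (∁ S) × (∀ e → e ∈ F → ends e ⊆ W))
      growTree root zero _ =
        ⁅ root ⁆ , ⊥ , x∈⁅x⁆ root , ∣⁅x⁆∣≡1 root , z≤n ,
        (λ e∈⊥ → contradiction e∈⊥ ∉⊥) , λ _ e∈⊥ → contradiction e∈⊥ ∉⊥
      growTree root (suc k) k<∣V∣
        with W , F , root∈W , ∣W∣≡ , k≤∣F∣ , F⊆ , F-inside ← growTree root k (<⇒≤ k<∣V∣)
        -- `W` has `suc k` nodes, fewer than `∣V∣`, so some node is not yet reached.
        with B , B∉W ← ∣p∣<n⇒∃∉ W (subst (_< ∣V∣ G) (sym ∣W∣≡) k<∣V∣)
        with w , _ , av ← conn root B (λ { refl → B∉W root∈W }) S ∣S∣≡t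
        with e , X , Y , eq , ce∉S , X∈W , Y∉W ← exitEdge W w av root∈W B∉W =
          ⁅ Y ⁆ ∪ W , ⁅ e ⁆ ∪ F , q⊆p∪q ⁅ Y ⁆ W root∈W ,
          trans (≤-antisym (∣⁅x⁆∪p∣≤1+∣p∣ Y W) (x∉p⇒∣p∣<∣⁅x⁆∪p∣ Y∉W)) (cong suc ∣W∣≡) ,
          ≤-<-trans k≤∣F∣ (x∉p⇒∣p∣<∣⁅x⁆∪p∣ e∉F) ,
          (λ {x} x∈ → [ (λ x∈⁅e⁆ → subst (_∈ preimage color (∁ S)) (sym (x∈⁅y⁆⇒x≡y e x∈⁅e⁆)) e∈)
                      , F⊆ ]′ (x∈p∪q⁻ ⁅ e ⁆ F x∈)) ,
          λ x x∈ → [ (λ x∈⁅e⁆ → subst (λ x → ends x ⊆ ⁅ Y ⁆ ∪ W) (sym (x∈⁅y⁆⇒x≡y e x∈⁅e⁆)) ends-e⊆)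
                   , (λ x∈F → q⊆p∪q ⁅ Y ⁆ W ∘ F-inside x x∈F) ]′ (x∈p∪q⁻ ⁅ e ⁆ F x∈)
        where
        e∈ : e ∈ preimage color (∁ S)
        e∈ = ∈-preimage⁺ color (x∉p⇒x∈∁p ce∉S)
        Y∈e : Y ∈ ends e
        Y∈e = subst (Y ∈_) (sym eq) (q⊆p∪q ⁅ X ⁆ _ (x∈⁅x⁆ Y))
        -- The end `Y` of `e` lies outside `W`, unlike the ends of every edge in `F`.
        e∉F : e ∉ F
        e∉F e∈F = Y∉W (F-inside e e∈F Y∈e)
        ends-e⊆ : ends e ⊆ ⁅ Y ⁆ ∪ W
        ends-e⊆ {x} x∈e with x∈p∪q⁻ ⁅ X ⁆ ⁅ Y ⁆ (subst (x ∈_) eq x∈e)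
        ... | inj₁ x∈⁅X⁆ = q⊆p∪q ⁅ Y ⁆ W (subst (_∈ W) (sym (x∈⁅y⁆⇒x≡y X x∈⁅X⁆)) X∈W)
        ... | inj₂ x∈⁅Y⁆ = p⊆p∪q W x∈⁅Y⁆

      ∣V∣∸1≤∣avoiding∣ : 2 ≤ ∣V∣ G → ∣V∣ G ∸ 1 ≤ ∣ preimage color (∁ S) ∣
      ∣V∣∸1≤∣avoiding∣ 2≤∣V∣
        with root , _ ← ∣p∣<n⇒∃∉ ⊥ (subst (_< ∣V∣ G) (sym (∣⊥∣≡0 (∣V∣ G))) (<⇒≤ 2≤∣V∣))
        with W , F , _ , _ , k≤∣F∣ , F⊆ , _ ←
          growTree root (∣V∣ G ∸ 1) (∸-monoʳ-< (s≤s z≤n) (<⇒≤ 2≤∣V∣)) =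
        ≤-trans k≤∣F∣ (p⊆q⇒∣p∣≤∣q∣ F⊆)

    -- The edges with colors in `S` and those with colors outside `S` partition the edge set, so the
    -- lower bounds for the two classes add up.
    threshold-bound : 2 ≤ ∣V∣ G → (p : ℕ) → (∣C∣ G ∸ t) * p < ∣V∣ G ∸ 1 →
      t * suc p + (∣V∣ G ∸ 1) ≤ ∣E∣ G
    threshold-bound 2≤∣V∣ p small
      with subsetInsideOrOutside (λ c → suc p ≤? ∣ fibre color c ∣) t≤∣C∣
    ... | S , ∣S∣≡t , inj₁ large = begin
      t * suc p + (∣V∣ G ∸ 1)
        ≡⟨ cong (λ s → s * suc p + (∣V∣ G ∸ 1)) ∣S∣≡t ⟨
      ∣ S ∣ * suc p + (∣V∣ G ∸ 1)
        ≤⟨ +-mono-≤ (∣preimage∣-lower color S (suc p) large) (∣V∣∸1≤∣avoiding∣ S ∣S∣≡t 2≤∣V∣) ⟩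
      ∣ preimage color S ∣ + ∣ preimage color (∁ S) ∣
        ≡⟨ ∣preimage∣+∣preimage-∁∣ color S ⟩
      ∣E∣ G ∎
      where open ≤-Reasoning
    ... | S , ∣S∣≡t , inj₂ ¬large = contradiction small (≤⇒≯ (begin
      ∣V∣ G ∸ 1                ≤⟨ ∣V∣∸1≤∣avoiding∣ S ∣S∣≡t 2≤∣V∣ ⟩
      ∣ preimage color (∁ S) ∣ ≤⟨ ∣preimage∣-upper color (∁ S) p small-fibre ⟩
      ∣ ∁ S ∣ * p              ≡⟨ cong (_* p) (∣∁p∣≡n∸∣p∣ S) ⟩
      (∣C∣ G ∸ ∣ S ∣) * p      ≡⟨ cong (λ s → (∣C∣ G ∸ s) * p) ∣S∣≡t ⟩
      (∣C∣ G ∸ t) * p          ∎))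
      where
      open ≤-Reasoning
      small-fibre : ∀ c → c ∈ ∁ S → ∣ fibre color c ∣ ≤ p
      small-fibre c c∈∁S = ≮⇒≥ (¬large c (x∈∁p⇒x∉p c∈∁S))

theorem4p6 : ∀ (m t n ℓ : ℕ) → m > 0 → t > 0 → n > 0 → ℓ > 0 → m ∸ 1 > t →
    (Σ[ G ∈ ColoredEdgeGraph ]
    ([ t +1]-ColorConnected G × ∣V∣ G ≡ n × ∣E∣ G ≡ ℓ × ∣C∣ G ≡ m)) →
    (2 * ℓ ≥ (t + 1) * n)
    × (∀ (k : ℕ) → k > 0 → n ≡ (m ∸ t) * k → ℓ ≥ m * k ∸ 1)
    × (∀ (k : ℕ) → k > 0 → n ≡ (m ∸ t) * k + 1 → ℓ ≥ m * k)
    × (∀ (j : ℕ) → 2 ≤ j → j ≤ m ∸ t ∸ 1 →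
    ∀ (k : ℕ) → k > 0 → n ≡ (m ∸ t) * k + j → ℓ ≥ m * k + t + j ∸ 1)
theorem4p6 m t n ℓ m>0 _ _ ℓ>0 m∸1>t (G , conn , refl , refl , refl) =
    [t+1]*∣V∣≤2*∣E∣ G conn t≤m 2≤n , multiple , multiple+1 , multiple+j
  where
  open ≤-Reasoning
  d = m ∸ t

  2+t≤m : 2 + t ≤ m
  2+t≤m = subst (2 + t ≤_) (m+[n∸m]≡n m>0) (s≤s m∸1>t)

  t≤m : t ≤ m
  t≤m = m+n≤o⇒n≤o 2 2+t≤m

  2≤d : 2 ≤ d
  2≤d = m+n≤o⇒m≤o∸n 2 2+t≤m

  -- Since `ℓ > 0` there is an edge, and its ends form a two-element set of nodes.
  2≤n : 2 ≤ n
  2≤n with e , _ ← ∣p∣<n⇒∃∉ ⊥ (subst (_< ℓ) (sym (∣⊥∣≡0 ℓ)) ℓ>0) =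
    subst (_≤ n) (ColoredEdgeGraph.ends-size G e) (∣p∣≤n (ColoredEdgeGraph.ends G e))

  m*k≡ : ∀ k → m * k ≡ t * k + d * k
  m*k≡ k = trans (cong (_* k) (sym (m+[n∸m]≡n t≤m))) (*-distribʳ-+ k t d)

  -- The variable `r` stands for `n ∸ 1`, so that each case can supply its own expression for it.
  bound : ∀ {r} p → n ∸ 1 ≡ r → d * p < r → t * suc p + r ≤ ℓ
  bound p refl = threshold-bound G conn t≤m 2≤n p

  multiple : ∀ k → k > 0 → n ≡ d * k → ℓ ≥ m * k ∸ 1
  multiple (suc k) _ n≡ = begin
    m * suc k ∸ 1               ≡⟨ cong (_∸ 1) (m*k≡ (suc k)) ⟩
    t * suc k + d * suc k ∸ 1   ≡⟨ +-∸-assoc (t * suc k) (≤-trans (m≤m+n 1 _) 2+d*k≤) ⟩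
    -- The threshold is one less than the multiplier `suc k`. Strictness needs a gap of two between
    -- `d * k` and `d * suc k`, because of the subtracted 1; this is `2 ≤ d`.
    t * suc k + (d * suc k ∸ 1) ≤⟨ bound k (cong (_∸ 1) n≡) (∸-monoˡ-≤ 1 2+d*k≤) ⟩
    ℓ                           ∎
    where
    2+d*k≤ : 2 + d * k ≤ d * suc k
    2+d*k≤ = subst (2 + d * k ≤_) (sym (*-suc d k)) (+-monoˡ-≤ (d * k) 2≤d)

  multiple+1 : ∀ k → k > 0 → n ≡ d * k + 1 → ℓ ≥ m * k
  multiple+1 (suc k) _ n≡ = begin
    m * suc k             ≡⟨ m*k≡ (suc k) ⟩
    t * suc k + d * suc k ≤⟨ bound k (trans (cong (_∸ 1) n≡) (m+n∸n≡m (d * suc k) 1)) d*k< ⟩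
    ℓ                     ∎
    where
    d*k< : d * k < d * suc k
    d*k< = subst (d * k <_) (sym (*-suc d k)) (+-monoˡ-≤ (d * k) (<⇒≤ 2≤d))

  multiple+j : ∀ j → 2 ≤ j → j ≤ d ∸ 1 → ∀ k → k > 0 → n ≡ d * k + j → ℓ ≥ m * k + t + j ∸ 1
  multiple+j (suc j) (s≤s 1≤j) _ k _ n≡ = begin
    m * k + t + suc j ∸ 1     ≡⟨ cong (_∸ 1) (+-suc (m * k + t) j) ⟩
    m * k + t + j             ≡⟨ cong (λ x → x + t + j) (m*k≡ k) ⟩
    t * k + d * k + t + j     ≡⟨ solve 4 (λ t x y j → x :+ y :+ t :+ j := t :+ x :+ (y :+ j)) refl t (t * k) (d * k) j ⟩
    t + t * k + (d * k + j)   ≡⟨ cong (_+ (d * k + j)) (*-suc t k) ⟨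
    -- The threshold is now the multiplier `k` itself, which yields the additional `t`. With `suc j`
    -- as the remainder, `n ∸ 1` is `d * k + j`, and `1 ≤ j` makes it exceed `d * k`.
    t * suc k + (d * k + j)   ≤⟨ bound k (cong (_∸ 1) (trans n≡ (+-suc (d * k) j))) (m<m+n (d * k) 1≤j) ⟩
    ℓ                         ∎
    where open +-*-Solver
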